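{- Binary concatenation is definable in the first-order theory of the structure $\mathfrak{S}_{\sqsubseteq,f,c}=\langle\Sigma^*,(s)_{s\in\Sigma^*},f,\sqsubseteq\rangle$; that is, there is a first-order formula $\varphi(x,y,z)$ in the vocabulary of this structure such that for all $r,s,t\in\Sigma^*$, $\mathfrak{S}_{\sqsubseteq,f,c}\models\varphi(r,s,t)$ if and only if $r^\frown s=t$.
   Context: $\Sigma^*$ is the set of finite words over the alphabet $\{1,2\}$, including the empty word; $^\frown$ is concatenation of words. The vocabulary consists of a constant $\underline{s}$ for each $s\in\Sigma^*$ (denoting $s$), a unary function symbol $f$, interpreted as reversal of words ($f(w)=w^{ -1}$), and a binary relation symbol $\sqsubseteq$, where $s\sqsubseteq t$ means that $s$ is an initial segment of $t$ ($t=s^\frown u$ for some $u\in\Sigma^*$). Formulas are first-order with equality. -}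

module Defs where

open import Data.Nat.Base using (ℕ; suc)
open import Data.Fin.Base using (Fin)
open import Data.List.Base using (List; _++_; reverse)
open import Data.Vec.Base using (Vec; _∷_; lookup)
open import Data.Product.Base using (_×_; ∃-syntax)
open import Data.Sum.Base using (_⊎_)
open import Data.Empty using (⊥)
open import Relation.Nullary.Negation.Core using (¬_)
open import Relation.Binary.PropositionalEquality.Core using (_≡_)

data Letter : Set where
  𝟏 𝟐 : Letter

Word : Set
Word = List Letter

infix 4 _⊑_

_⊑_ : Word → Word → Set
s ⊑ t = ∃[ u ] t ≡ s ++ u

-- Terms and formulas are well scoped: the free variables of a term or
-- formula indexed by n are among the de Bruijn indices in Fin n.

data Term (n : ℕ) : Set where
  var   : Fin n → Term n
  const : Word → Term n
  f     : Term n → Term n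

infix  8 _≐_ _⊑′_
infix  7 ¬′_
infixr 6 _∧′_
infixr 5 _∨′_
infixr 4 _⇒′_
infix  3 ∀′_ ∃′_

data Formula (n : ℕ) : Set where
  _≐_  : Term n → Term n → Formula n
  _⊑′_ : Term n → Term n → Formula n
  ⊥′   : Formula n
  ¬′_  : Formula n → Formula n
  _∧′_ : Formula n → Formula n → Formula n
  _∨′_ : Formula n → Formula n → Formula n
  _⇒′_ : Formula n → Formula n → Formula n
  ∀′_  : Formula (suc n) → Formula n
  ∃′_  : Formula (suc n) → Formula n

⟦_⟧ : ∀ {n} → Term n → Vec Word n → Word
⟦ var i ⟧   ρ = lookup ρ i
⟦ const s ⟧ ρ = s
⟦ f t ⟧     ρ = reverse (⟦ t ⟧ ρ)

-- Satisfaction in the structure ⟨Σ*, (s)_{s ∈ Σ*}, f, ⊑⟩.  A quantifier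
-- binds index zero, so its witness goes to the front of the assignment.  Connectives
-- and quantifiers are those of the metatheory; in the presence of excluded
-- middle this is Tarski's classical satisfaction.  They are all primitive
-- because constructively they are not interdefinable.

infix 2 𝔖⊨_[_]

𝔖⊨_[_] : ∀ {n} → Formula n → Vec Word n → Set
𝔖⊨ t ≐ u    [ ρ ] = ⟦ t ⟧ ρ ≡ ⟦ u ⟧ ρ
𝔖⊨ t ⊑′ u   [ ρ ] = ⟦ t ⟧ ρ ⊑ ⟦ u ⟧ ρ
𝔖⊨ ⊥′       [ ρ ] = ⊥
𝔖⊨ ¬′ φ     [ ρ ] = ¬ (𝔖⊨ φ [ ρ ])
𝔖⊨ φ ∧′ ψ   [ ρ ] = (𝔖⊨ φ [ ρ ]) × (𝔖⊨ ψ [ ρ ])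
𝔖⊨ φ ∨′ ψ   [ ρ ] = (𝔖⊨ φ [ ρ ]) ⊎ (𝔖⊨ ψ [ ρ ])
𝔖⊨ φ ⇒′ ψ   [ ρ ] = 𝔖⊨ φ [ ρ ] → 𝔖⊨ ψ [ ρ ]
𝔖⊨ ∀′ φ     [ ρ ] = ∀ w → 𝔖⊨ φ [ w ∷ ρ ]
𝔖⊨ ∃′ φ     [ ρ ] = ∃[ w ] 𝔖⊨ φ [ w ∷ ρ ]

{-# OPTIONS --safe #-}

-- The factor relation is definable, so a word W and a separator G code the finite set
-- of maximal G-free factors of W.  A maximal factor z codes a pair (x , y): x is the
-- longest common prefix, and y the longest common suffix, of z and a fixed word K.
-- Suppose every coded pair is either (B , Y) or arises from another coded pair by
-- moving the first letter of its second component to the end of its first one.  Then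
-- x ++ y ≡ B ++ Y for all coded pairs, whatever W, G and K are.  Taking B ∈ 2*1 and
-- Y ∈ t12*, and asking for a coded pair with x ∈ 2*1r and y ∈ s12*, forces r ++ s ≡ t.
-- Conversely, let N = 2ᵐ with m large, G = N2 and K = N1t1N; then the words
-- N1p āb̄ q1N with p ++ q ≡ t, where ā differs from the first letter of q1 and b̄ from
-- the last letter of 1p, can be strung together to a suitable W.
module Submission where

open import Data.Empty using (⊥-elim)
open import Data.Fin.Base using (suc)
open import Data.Fin.Patterns
open import Data.List.Base using (List; []; _∷_; [_]; _++_; length; map; replicate; reverse; initLast; _∷ʳ′_)
open import Data.List.Membership.Propositional using (_∈_)
open import Data.List.Membership.Propositional.Properties using (∈-map⁺; ∈-map⁻)
open import Data.List.Properties
  using (++-assoc; ++-cancelˡ; ++-conicalˡ; ++-identityʳ; ∷-injectiveʳ; length-++; length-replicate;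
         reverse-++; reverse-involutive; reverse-injective; unfold-reverse)
open import Data.List.Relation.Unary.Any using (here; there)
open import Data.Nat.Base using (ℕ; zero; suc; _+_; _≤_; s≤s)
open import Data.Nat.Properties
  using (≤-refl; ≤-reflexive; ≤-trans; <-irrefl; +-comm; m≤m+n; m≤n+m; m+1+n≰m; module ≤-Reasoning)
open import Data.Product.Base using (_×_; _,_; proj₁; proj₂; ∃-syntax; Σ-syntax)
open import Data.Sum.Base using (_⊎_; inj₁; inj₂)
open import Data.Vec.Base using ([]; _∷_)
open import Function.Base using (case_of_)
open import Function.Bundles using (_⇔_; mk⇔)
open import Relation.Nullary.Negation.Core using (¬_)
open import Relation.Binary.PropositionalEquality.Core using (_≡_; _≢_; refl; sym; trans; cong; cong₂; subst)
open import Relation.Binary.PropositionalEquality.Properties using (module ≡-Reasoning)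
open import Defs

-- Formulas

wk : ∀ {n} → Term n → Term (suc n)
wk (var i)   = var (suc i)
wk (const s) = const s
wk (f t)     = f (wk t)

-- A factor is a suffix of a prefix, and `f` turns suffixes into prefixes.
factor′ : ∀ {n} → Term n → Term n → Formula n
factor′ z w = ∃′ var 0F ⊑′ wk w ∧′ f (wk z) ⊑′ f (var 0F)

-- Adding one letter means covering `u` in the prefix order; which letter it is shows at the front
-- of `f w`.
snoc′ : ∀ {n} → Letter → Term n → Term n → Formula n
snoc′ a u w =
  const [ a ] ⊑′ f w ∧′ u ⊑′ w ∧′ ¬′ (w ⊑′ u) ∧′
  (∀′ var 0F ⊑′ wk w ⇒′ var 0F ⊑′ wk u ∨′ wk w ⊑′ var 0F)

-- This puts `v` in `u`12*: the witness is `u`1, and every longer prefix of `v` has to end in 2.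
pad′ : ∀ {n} → Term n → Term n → Formula n
pad′ u v =
  ∃′ snoc′ 𝟏 (wk u) (var 0F) ∧′ var 0F ⊑′ wk v ∧′
     (∀′ var 0F ⊑′ wk (wk v) ⇒′ var 0F ⊑′ var 1F ∨′ const [ 𝟐 ] ⊑′ f (var 0F))

lcp′ : ∀ {n} → Term n → Term n → Term n → Formula n
lcp′ x z k = x ⊑′ z ∧′ x ⊑′ k ∧′ (∀′ var 0F ⊑′ wk z ⇒′ var 0F ⊑′ wk k ⇒′ var 0F ⊑′ wk x)

maximal′ : ∀ {n} → Term n → Term n → Term n → Formula n
maximal′ w g z =
  factor′ z w ∧′ ¬′ factor′ g z ∧′
  (∀′ factor′ (wk z) (var 0F) ⇒′ factor′ (var 0F) (wk w) ⇒′ ¬′ factor′ (wk g) (var 0F) ⇒′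
      var 0F ≐ wk z)

coded′ : ∀ {n} → Term n → Term n → Term n → Term n → Term n → Formula n
coded′ w g k x y =
  ∃′ maximal′ (wk w) (wk g) (var 0F) ∧′
     lcp′ (wk x) (var 0F) (wk k) ∧′ lcp′ (f (wk y)) (f (var 0F)) (f (wk k))

move′ : ∀ {n} → Letter → Term n → Term n → Term n → Term n → Formula n
move′ a x₁ y₁ x y = snoc′ a x₁ x ∧′ snoc′ a (f y) (f y₁)

closed′ : ∀ {n} → Term n → Term n → Term n → Term n → Term n → Formula n
closed′ w g k b y₀ =
  ∀′ ∀′ coded′ (wk (wk w)) (wk (wk g)) (wk (wk k)) (var 1F) (var 0F) ⇒′
    (var 1F ≐ wk (wk b) ∧′ var 0F ≐ wk (wk y₀)) ∨′
    -- Inside, variables 3 and 2 are the given pair, 1 and 0 its predecessor. Letters are not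
    -- quantified over, so each gets its own disjunct.
    (∃′ ∃′ coded′ (wk (wk (wk (wk w)))) (wk (wk (wk (wk g)))) (wk (wk (wk (wk k)))) (var 1F) (var 0F) ∧′
      (move′ 𝟏 (var 1F) (var 0F) (var 3F) (var 2F) ∨′ move′ 𝟐 (var 1F) (var 0F) (var 3F) (var 2F)))

concat′ : Formula 3
concat′ =
  ∃′ ∃′ ∃′ ∃′ ∃′ ∃′ ∃′
    -- Reversing both arguments pads on the left instead: `b` is in 2*1 and `x` in 2*1`r`.
    pad′ (const []) (f b) ∧′ pad′ t y₀ ∧′ pad′ (f r) (f x) ∧′ pad′ s y ∧′
    coded′ w g k x y ∧′ closed′ w g k b y₀
  where
  y = var 0F ; x = var 1F ; y₀ = var 2F ; b = var 3F ; k = var 4F ; g = var 5F ; w = var 6F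
  r = var 7F ; s = var 8F ; t = var 9F

-- Evaluation of wk t reduces for every concrete t, so these instances are definitionally
-- the meanings of the formulas in all contexts where they occur.

Factor : Word → Word → Set
Factor z w = 𝔖⊨ factor′ (var 0F) (var 1F) [ z ∷ w ∷ [] ]

Snoc : Letter → Word → Word → Set
Snoc a u w = 𝔖⊨ snoc′ a (var 0F) (var 1F) [ u ∷ w ∷ [] ]

Pad : Word → Word → Set
Pad u v = 𝔖⊨ pad′ (var 0F) (var 1F) [ u ∷ v ∷ [] ]

Lcp : Word → Word → Word → Set
Lcp x z k = 𝔖⊨ lcp′ (var 0F) (var 1F) (var 2F) [ x ∷ z ∷ k ∷ [] ]

Maximal : Word → Word → Word → Set
Maximal w g z = 𝔖⊨ maximal′ (var 0F) (var 1F) (var 2F) [ w ∷ g ∷ z ∷ [] ]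

Coded : Word → Word → Word → Word → Word → Set
Coded w g k x y =
  𝔖⊨ coded′ (var 0F) (var 1F) (var 2F) (var 3F) (var 4F) [ w ∷ g ∷ k ∷ x ∷ y ∷ [] ]

Closed : Word → Word → Word → Word → Word → Set
Closed w g k b y₀ =
  𝔖⊨ closed′ (var 0F) (var 1F) (var 2F) (var 3F) (var 4F) [ w ∷ g ∷ k ∷ b ∷ y₀ ∷ [] ]

-- Prefixes

⊑-refl : ∀ {w} → w ⊑ w
⊑-refl {w} = [] , sym (++-identityʳ w)

⊑-++ : ∀ {u} v → u ⊑ u ++ v
⊑-++ v = v , refl

⊑-trans : ∀ {u v w} → u ⊑ v → v ⊑ w → u ⊑ w
⊑-trans {u} (p , refl) (q , refl) = p ++ q , ++-assoc u p q

⊑-∷ : ∀ {u v} a → u ⊑ v → a ∷ u ⊑ a ∷ v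
⊑-∷ a (p , eq) = p , cong (a ∷_) eq

⊑-∷⁻ : ∀ {a b u v} → a ∷ u ⊑ b ∷ v → a ≡ b × u ⊑ v
⊑-∷⁻ (p , refl) = refl , p , refl

⊑-++⁻ˡ : ∀ u {v w} → u ++ v ⊑ u ++ w → v ⊑ w
⊑-++⁻ˡ u {v} {w} (p , eq) = p , ++-cancelˡ u w (v ++ p) (trans eq (++-assoc u v p))

⊑-antisym : ∀ {u v} → u ⊑ v → v ⊑ u → u ≡ v
⊑-antisym {[]}    {[]}    _ _ = refl
⊑-antisym {[]}    {_ ∷ _} _ (_ , ())
⊑-antisym {_ ∷ _} {[]}    (_ , ()) _
⊑-antisym {_ ∷ _} {_ ∷ _} p q =
  cong₂ _∷_ (proj₁ (⊑-∷⁻ p)) (⊑-antisym (proj₂ (⊑-∷⁻ p)) (proj₂ (⊑-∷⁻ q)))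

⊑-compare : ∀ {u v w} → u ⊑ w → v ⊑ w → u ⊑ v ⊎ v ⊑ u
⊑-compare {[]}    {v}     _ _ = inj₁ (v , refl)
⊑-compare {a ∷ u} {[]}    _ _ = inj₂ (a ∷ u , refl)
⊑-compare {_ ∷ _} {_ ∷ _} {[]} (_ , ()) _
⊑-compare {a ∷ u} {b ∷ v} {_ ∷ _} p q with ⊑-∷⁻ p | ⊑-∷⁻ q
... | refl , p′ | refl , q′ with ⊑-compare p′ q′
... | inj₁ l = inj₁ (⊑-∷ a l)
... | inj₂ l = inj₂ (⊑-∷ a l)

⊑-∷ʳ⁻ : ∀ {p} u {a} → p ⊑ u ++ [ a ] → p ⊑ u ⊎ p ≡ u ++ [ a ]
⊑-∷ʳ⁻ {[]}    u       _ = inj₁ (u , refl)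
⊑-∷ʳ⁻ {_ ∷ p} []      l with ⊑-∷⁻ l
... | refl , (q , eq) = inj₂ (cong (_ ∷_) (++-conicalˡ p q (sym eq)))
⊑-∷ʳ⁻ {_ ∷ p} (b ∷ u) l with ⊑-∷⁻ l
... | refl , l′ with ⊑-∷ʳ⁻ u l′
... | inj₁ h = inj₁ (⊑-∷ b h)
... | inj₂ h = inj₂ (cong (b ∷_) h)

∷ʳ-⋢ : ∀ u {a v} → ¬ u ++ a ∷ v ⊑ u
∷ʳ-⋢ u {a} {v} (q , eq)
  with ++-cancelˡ u [] (a ∷ v ++ q) (trans (++-identityʳ u) (trans eq (++-assoc u (a ∷ v) q)))
... | ()

reverse-∷ʳ : ∀ u (a : Letter) → reverse (u ++ [ a ]) ≡ a ∷ reverse u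
reverse-∷ʳ u a = reverse-++ u [ a ]

reverse-++-∷ : ∀ u (a : Letter) v → reverse (u ++ a ∷ v) ≡ reverse v ++ a ∷ reverse u
reverse-++-∷ u a v =
  trans (reverse-++ u (a ∷ v))
    (trans (cong (_++ reverse u) (unfold-reverse a v)) (++-assoc (reverse v) [ a ] (reverse u)))

last-⊑ : ∀ {a b} u → [ a ] ⊑ reverse (u ++ [ b ]) → a ≡ b
last-⊑ u l = proj₁ (⊑-∷⁻ (subst ([ _ ] ⊑_) (reverse-∷ʳ u _) l))

Snoc⇒≡ : ∀ {a} u w → Snoc a u w → w ≡ u ++ [ a ]
Snoc⇒≡ u _ (l , ([] , refl) , w⋢u , _) = ⊥-elim (w⋢u (subst (_⊑ u) (sym (++-identityʳ u)) ⊑-refl))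
Snoc⇒≡ u _ (l , (c ∷ v , refl) , _ , between)
  -- The word `u ++ [ c ]` is too long to be a prefix of `u`, so it has all of `w` as a prefix,
  -- which leaves `v` empty.
  with between (u ++ [ c ]) (v , sym (++-assoc u [ c ] v))
... | inj₁ h = ⊥-elim (∷ʳ-⋢ u h)
... | inj₂ h with ⊑-∷⁻ (⊑-++⁻ˡ u h)
... | _ , (q , eq) with ++-conicalˡ v q (sym eq)
... | refl = cong (λ b → u ++ [ b ]) (sym (last-⊑ u l))

Snoc-++ : ∀ a u → Snoc a u (u ++ [ a ])
Snoc-++ a u =
  (reverse u , reverse-∷ʳ u a) , ⊑-++ [ a ] , ∷ʳ-⋢ u ,
  λ p l → case ⊑-∷ʳ⁻ u l of λ { (inj₁ h) → inj₁ h ; (inj₂ refl) → inj₂ ⊑-refl }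

-- Padding

𝟐^ : ℕ → Word
𝟐^ k = replicate k 𝟐

𝟐^-∷ʳ : ∀ k → 𝟐^ k ++ [ 𝟐 ] ≡ 𝟐^ (suc k)
𝟐^-∷ʳ zero    = refl
𝟐^-∷ʳ (suc k) = cong (𝟐 ∷_) (𝟐^-∷ʳ k)

reverse-𝟐^ : ∀ k → reverse (𝟐^ k) ≡ 𝟐^ k
reverse-𝟐^ zero    = refl
reverse-𝟐^ (suc k) = trans (unfold-reverse 𝟐 (𝟐^ k)) (trans (cong (_++ [ 𝟐 ]) (reverse-𝟐^ k)) (𝟐^-∷ʳ k))

-- Induction on `e`, handing its letters to `w` one at a time: `w ++ [ c ]` is not a prefix of `w`,
-- so `c` is 2, and the hypothesis survives because its first alternative only gets weaker.
all-𝟐 : ∀ w e → (∀ p → p ⊑ w ++ e → p ⊑ w ⊎ [ 𝟐 ] ⊑ reverse p) → ∃[ k ] e ≡ 𝟐^ k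
all-𝟐 w []      _ = 0 , refl
all-𝟐 w (c ∷ e) h with h (w ++ [ c ]) (e , sym (++-assoc w [ c ] e))
... | inj₁ l = ⊥-elim (∷ʳ-⋢ w l)
... | inj₂ l with last-⊑ w l
... | refl with all-𝟐 (w ++ [ 𝟐 ]) e
                  (λ p l′ → case h p (subst (p ⊑_) (++-assoc w [ 𝟐 ] e) l′) of λ
                    { (inj₁ l″) → inj₁ (⊑-trans l″ (⊑-++ [ 𝟐 ])) ; (inj₂ l″) → inj₂ l″ })
... | k , refl = suc k , refl

Pad⇒≡ : ∀ u v → Pad u v → ∃[ k ] v ≡ u ++ 𝟏 ∷ 𝟐^ k
Pad⇒≡ u v (w , sn , (e , refl) , h) with Snoc⇒≡ u w sn | all-𝟐 w e h
... | refl | k , refl = k , ++-assoc u [ 𝟏 ] (𝟐^ k)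

⊑-++-𝟐^ : ∀ w k {p} → p ⊑ w ++ 𝟐^ k → p ⊑ w ⊎ [ 𝟐 ] ⊑ reverse p
⊑-++-𝟐^ w zero    l = inj₁ (subst (_ ⊑_) (++-identityʳ w) l)
⊑-++-𝟐^ w (suc k) l
  with ⊑-∷ʳ⁻ (w ++ 𝟐^ k)
         (subst (_ ⊑_) (trans (cong (w ++_) (sym (𝟐^-∷ʳ k))) (sym (++-assoc w (𝟐^ k) [ 𝟐 ]))) l)
... | inj₁ l′   = ⊑-++-𝟐^ w k l′
... | inj₂ refl = inj₂ (reverse (w ++ 𝟐^ k) , reverse-∷ʳ (w ++ 𝟐^ k) 𝟐)

Pad-++ : ∀ u k → Pad u (u ++ 𝟏 ∷ 𝟐^ k)
Pad-++ u k =
  u ++ [ 𝟏 ] , Snoc-++ 𝟏 u , (𝟐^ k , eq) , λ p l → ⊑-++-𝟐^ (u ++ [ 𝟏 ]) k (subst (p ⊑_) eq l)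
  where eq = sym (++-assoc u [ 𝟏 ] (𝟐^ k))

reverse-padded : ∀ u k → reverse (𝟐^ k ++ 𝟏 ∷ u) ≡ reverse u ++ 𝟏 ∷ 𝟐^ k
reverse-padded u k = trans (reverse-++-∷ (𝟐^ k) 𝟏 u) (cong (λ e → reverse u ++ 𝟏 ∷ e) (reverse-𝟐^ k))

Pad-reverse⇒≡ : ∀ u v → Pad (reverse u) (reverse v) → ∃[ k ] v ≡ 𝟐^ k ++ 𝟏 ∷ u
Pad-reverse⇒≡ u v h with Pad⇒≡ (reverse u) (reverse v) h
... | k , eq = k , reverse-injective (trans eq (sym (reverse-padded u k)))

Pad-reverse-++ : ∀ u k → Pad (reverse u) (reverse (𝟐^ k ++ 𝟏 ∷ u))
Pad-reverse-++ u k = subst (Pad (reverse u)) (sym (reverse-padded u k)) (Pad-++ (reverse u) k)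

-- The first 1 marks the end of the padding, which can thus be stripped without knowing its length.
𝟐^-𝟏-cancel : ∀ j k {u v} → 𝟐^ j ++ 𝟏 ∷ u ≡ 𝟐^ k ++ 𝟏 ∷ v → u ≡ v
𝟐^-𝟏-cancel zero    zero    refl = refl
𝟐^-𝟏-cancel (suc j) (suc k) eq   = 𝟐^-𝟏-cancel j k (∷-injectiveʳ eq)

𝟏-𝟐^-cancel : ∀ u v j k → u ++ 𝟏 ∷ 𝟐^ j ≡ v ++ 𝟏 ∷ 𝟐^ k → u ≡ v
𝟏-𝟐^-cancel u v j k eq =
  reverse-injective (𝟐^-𝟏-cancel j k (trans (sym (rev u j)) (trans (cong reverse eq) (rev v k))))
  where
  rev : ∀ u j → reverse (u ++ 𝟏 ∷ 𝟐^ j) ≡ 𝟐^ j ++ 𝟏 ∷ reverse u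
  rev u j = trans (reverse-++-∷ u 𝟏 (𝟐^ j)) (cong (_++ 𝟏 ∷ reverse u) (reverse-𝟐^ j))

-- Soundness

Move⇒≡ : ∀ {a x₁ y₁ x y} → Snoc a x₁ x → Snoc a (reverse y) (reverse y₁) →
         x ≡ x₁ ++ [ a ] × y₁ ≡ a ∷ y
Move⇒≡ {a} {x₁} {y₁} {x} {y} p q =
  Snoc⇒≡ x₁ x p ,
  reverse-injective (trans (Snoc⇒≡ (reverse y) (reverse y₁) q) (sym (unfold-reverse a y)))

-- A move preserves the concatenation, and tracing it back shortens the first component. Descent on
-- the bound `n` therefore has to end at `(b , y₀)`.
Closed⇒≡ : ∀ w g k b y₀ → Closed w g k b y₀ →
           ∀ n x y → length x ≤ n → Coded w g k x y → x ++ y ≡ b ++ y₀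
Closed⇒≡ w g k b y₀ closed n x y len c with closed x y c
... | inj₁ (refl , refl) = refl
... | inj₂ (x₁ , y₁ , c₁ , m) = back n len m
  where
  shift : ∀ {a} n → length x ≤ n → x ≡ x₁ ++ [ a ] × y₁ ≡ a ∷ y → x ++ y ≡ b ++ y₀
  -- Since `x` ends in `a`, its length is positive and the bound is a successor.
  shift {a} n len (refl , refl) with n | subst (_≤ n) (trans (length-++ x₁) (+-comm (length x₁) 1)) len
  ... | suc n′ | s≤s len′ =
    trans (++-assoc x₁ [ a ] y) (Closed⇒≡ w g k b y₀ closed n′ x₁ (a ∷ y) len′ c₁)

  back : ∀ n → length x ≤ n → _ → x ++ y ≡ b ++ y₀
  back n len (inj₁ (p , q)) = shift n len (Move⇒≡ {𝟏} {x₁} {y₁} p q)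
  back n len (inj₂ (p , q)) = shift n len (Move⇒≡ {𝟐} {x₁} {y₁} p q)

-- The invariant equates 2ʲ1rs12ˡ with 2ʰ1t12ⁱ. The outermost 1s delimit the paddings, so these
-- cancel without comparing exponents.
concat′-sound : ∀ r s t → 𝔖⊨ concat′ [ r ∷ s ∷ t ∷ [] ] → r ++ s ≡ t
concat′-sound r s t (w , g , k , b , y₀ , x , y , pb , py₀ , px , py , c , closed)
  with Pad-reverse⇒≡ [] b pb | Pad⇒≡ t y₀ py₀ | Pad-reverse⇒≡ r x px | Pad⇒≡ s y py
... | h , refl | i , refl | j , refl | l , refl =
  𝟏-𝟐^-cancel (r ++ s) t l i (𝟐^-𝟏-cancel j h (begin
    𝟐^ j ++ 𝟏 ∷ ((r ++ s) ++ 𝟏 ∷ 𝟐^ l)   ≡⟨ cong (λ v → 𝟐^ j ++ 𝟏 ∷ v) (++-assoc r s _) ⟩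
    𝟐^ j ++ 𝟏 ∷ r ++ (s ++ 𝟏 ∷ 𝟐^ l)     ≡⟨ ++-assoc (𝟐^ j) (𝟏 ∷ r) _ ⟨
    (𝟐^ j ++ 𝟏 ∷ r) ++ (s ++ 𝟏 ∷ 𝟐^ l)   ≡⟨ Closed⇒≡ w g k _ _ closed _ _ _ ≤-refl c ⟩
    (𝟐^ h ++ [ 𝟏 ]) ++ (t ++ 𝟏 ∷ 𝟐^ i)   ≡⟨ ++-assoc (𝟐^ h) [ 𝟏 ] _ ⟩
    𝟐^ h ++ 𝟏 ∷ (t ++ 𝟏 ∷ 𝟐^ i)          ∎))
  where open ≡-Reasoning

-- Factors

Occurs : Word → Word → Set
Occurs z w = ∃[ u ] ∃[ v ] w ≡ u ++ z ++ v

Factor⇒Occurs : ∀ z w → Factor z w → Occurs z w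
Factor⇒Occurs z _ (p , (v , refl) , (q , eq)) =
  reverse q , v , trans (cong (_++ v) p≡) (++-assoc (reverse q) z v)
  where
  p≡ : p ≡ reverse q ++ z
  p≡ = reverse-injective (trans eq
    (sym (trans (reverse-++ (reverse q) z) (cong (reverse z ++_) (reverse-involutive q)))))

Occurs⇒Factor : ∀ z w → Occurs z w → Factor z w
Occurs⇒Factor z _ (u , v , refl) =
  u ++ z , (v , sym (++-assoc u z v)) , (reverse u , reverse-++ u z)

Occurs-trans : ∀ {u v w} → Occurs u v → Occurs v w → Occurs u w
Occurs-trans {u} (a , b , refl) (c , d , refl) = c ++ a , b ++ d , (begin
  c ++ (a ++ u ++ b) ++ d   ≡⟨ cong (c ++_) (++-assoc a (u ++ b) d) ⟩
  c ++ a ++ (u ++ b) ++ d   ≡⟨ cong (λ e → c ++ a ++ e) (++-assoc u b d) ⟩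
  c ++ a ++ u ++ b ++ d     ≡⟨ ++-assoc c a _ ⟨
  (c ++ a) ++ u ++ b ++ d   ∎)
  where open ≡-Reasoning

⊑⇒Occurs : ∀ {u w} → u ⊑ w → Occurs u w
⊑⇒Occurs (v , eq) = [] , v , eq

Occurs-++ˡ : ∀ u {z w} → Occurs z w → Occurs z (u ++ w)
Occurs-++ˡ u {z} {w} o = Occurs-trans o (u , [] , cong (u ++_) (sym (++-identityʳ w)))

Occurs-++ʳ : ∀ {z w} v → Occurs z w → Occurs z (w ++ v)
Occurs-++ʳ v o = Occurs-trans o ([] , v , refl)

Occurs-length : ∀ {z w} → Occurs z w → length z ≤ length w
Occurs-length {z} (u , v , refl) = begin
  length z                        ≤⟨ m≤m+n (length z) (length v) ⟩
  length z + length v             ≡⟨ length-++ z ⟨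
  length (z ++ v)                 ≤⟨ m≤n+m _ (length u) ⟩
  length u + length (z ++ v)      ≡⟨ length-++ u ⟨
  length (u ++ z ++ v)            ∎
  where open ≤-Reasoning

Occurs-length-≡ : ∀ {z w} → Occurs z w → length w ≤ length z → z ≡ w
Occurs-length-≡ {z} ([] , [] , refl) _ = sym (++-identityʳ z)
Occurs-length-≡ {z} ([] , c ∷ v , refl) le =
  ⊥-elim (m+1+n≰m (length z) (subst (_≤ length z) (length-++ z) le))
Occurs-length-≡ {z} (c ∷ u , v , refl) le =
  ⊥-elim (<-irrefl refl (≤-trans (s≤s (Occurs-length (u , v , refl))) le))

length-𝟐^ : ∀ k → length (𝟐^ k) ≡ k
length-𝟐^ k = length-replicate k

𝟐^-long : ∀ {m w} → length w ≤ m → ¬ Occurs (𝟐^ (suc m)) w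
𝟐^-long {m} {w} le o =
  <-irrefl refl (≤-trans (subst (_≤ length w) (length-𝟐^ (suc m)) (Occurs-length o)) le)

𝟐^-no-𝟏 : ∀ n u {v} → 𝟐^ n ≢ u ++ 𝟏 ∷ v
𝟐^-no-𝟏 zero    []      ()
𝟐^-no-𝟏 zero    (_ ∷ _) ()
𝟐^-no-𝟏 (suc n) []      ()
𝟐^-no-𝟏 (suc n) (_ ∷ u) eq = 𝟐^-no-𝟏 n u (∷-injectiveʳ eq)

𝟐^-⊑-around-𝟏 : ∀ n u {v} → 𝟐^ n ⊑ u ++ 𝟏 ∷ v → 𝟐^ n ⊑ u
𝟐^-⊑-around-𝟏 n u {v} l with ⊑-compare l (⊑-++ (𝟏 ∷ v))
... | inj₁ h = h
... | inj₂ ([] , eq) = [] , sym (trans (++-identityʳ _) (trans eq (++-identityʳ u)))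
... | inj₂ (c ∷ q , eq) with ⊑-∷⁻ (⊑-++⁻ˡ u (subst (_⊑ u ++ 𝟏 ∷ v) eq l))
... | refl , _ = ⊥-elim (𝟐^-no-𝟏 n u eq)

𝟐^-around-𝟏 : ∀ n u {v} → Occurs (𝟐^ n) (u ++ 𝟏 ∷ v) → Occurs (𝟐^ n) u ⊎ Occurs (𝟐^ n) v
𝟐^-around-𝟏 n u ([] , e , eq)  = inj₁ (⊑⇒Occurs (𝟐^-⊑-around-𝟏 n u (e , eq)))
𝟐^-around-𝟏 n [] (_ ∷ d , e , eq) = inj₂ (d , e , ∷-injectiveʳ eq)
𝟐^-around-𝟏 n (a ∷ u) (_ ∷ d , e , eq) with 𝟐^-around-𝟏 n u (d , e , ∷-injectiveʳ eq)
... | inj₁ o = inj₁ (Occurs-++ˡ [ a ] o)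
... | inj₂ o = inj₂ o

⊑-free : ∀ m u {v z} → ¬ Occurs (𝟐^ (suc m)) z → z ⊑ u ++ 𝟐^ (suc m) ++ v → z ⊑ u ++ 𝟐^ m
⊑-free m u {v} {z} free l with ⊑-compare l (v , sym (++-assoc u (𝟐^ (suc m)) v))
... | inj₂ h = ⊥-elim (free (Occurs-trans (Occurs-++ˡ u ([] , [] , sym (++-identityʳ _))) (⊑⇒Occurs h)))
... | inj₁ h with ⊑-∷ʳ⁻ (u ++ 𝟐^ m)
                      (subst (z ⊑_) (trans (cong (u ++_) (sym (𝟐^-∷ʳ m))) (sym (++-assoc u (𝟐^ m) [ 𝟐 ]))) h)
... | inj₁ h′ = h′
... | inj₂ refl =
  ⊥-elim (free (u , [] , trans (++-assoc u (𝟐^ m) [ 𝟐 ]) (cong (u ++_) (trans (𝟐^-∷ʳ m) (sym (++-identityʳ _))))))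

-- A word without 2ᵐ⁺¹ cannot cover the displayed run: its occurrence stops before the last letter
-- of the run or starts after the first.
Occurs-free : ∀ m u {v z} → ¬ Occurs (𝟐^ (suc m)) z → Occurs z (u ++ 𝟐^ (suc m) ++ v) →
              Occurs z (u ++ 𝟐^ m) ⊎ Occurs z (𝟐^ m ++ v)
Occurs-free m u free ([] , e , eq) = inj₁ (⊑⇒Occurs (⊑-free m u free (e , eq)))
Occurs-free m [] free (_ ∷ d , e , eq) = inj₂ (d , e , ∷-injectiveʳ eq)
Occurs-free m (a ∷ u) free (_ ∷ d , e , eq) with Occurs-free m u free (d , e , ∷-injectiveʳ eq)
... | inj₁ o = inj₁ (Occurs-++ˡ [ a ] o)
... | inj₂ o = inj₂ o

-- Coding finite sets of words

block : ℕ → Word → Word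
block m c = 𝟐^ m ++ c ++ 𝟐^ m

-- Each word is followed by the separator 2ᵐ⁺¹, whose first m letters close its block and whose last
-- m letters open what follows. Neighbouring blocks may thus overlap.
string : ℕ → List Word → Word
string m []       = 𝟐^ m
string m (c ∷ cs) = 𝟐^ m ++ c ++ 𝟐 ∷ string m cs

𝟐^-⊑-string : ∀ m cs → 𝟐^ m ⊑ string m cs
𝟐^-⊑-string m []       = ⊑-refl
𝟐^-⊑-string m (c ∷ cs) = ⊑-++ _

string-∷ : ∀ m c cs → ∃[ v ] string m cs ≡ 𝟐^ m ++ v × string m (c ∷ cs) ≡ (𝟐^ m ++ c) ++ 𝟐^ (suc m) ++ v
string-∷ m c cs with 𝟐^-⊑-string m cs
... | v , eq = v , eq , trans (cong (λ e → 𝟐^ m ++ c ++ 𝟐 ∷ e) eq) (sym (++-assoc (𝟐^ m) c _))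

-- Cutting at one separator after another confines a free factor to a single block or to the final
-- 2ᵐ.
Occurs-string : ∀ m cs {z} → ¬ Occurs (𝟐^ (suc m)) z → Occurs z (string m cs) →
                Occurs z (𝟐^ m) ⊎ (∃[ c ] c ∈ cs × Occurs z (block m c))
Occurs-string m []       free o = inj₁ o
Occurs-string m (c ∷ cs) {z} free o with string-∷ m c cs
... | v , eq , eq′ with Occurs-free m (𝟐^ m ++ c) free (subst (Occurs z) eq′ o)
... | inj₁ o′ = inj₂ (c , here refl , subst (Occurs z) (++-assoc (𝟐^ m) c (𝟐^ m)) o′)
... | inj₂ o′ with Occurs-string m cs free (subst (Occurs z) (sym eq) o′)
... | inj₁ o″ = inj₁ o″
... | inj₂ (d , d∈ , o″) = inj₂ (d , there d∈ , o″)

block-Occurs-string : ∀ m {c} cs → c ∈ cs → Occurs (block m c) (string m cs)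
block-Occurs-string m (c ∷ cs) (here refl) with string-∷ m c cs
... | v , _ , eq = [] , 𝟐 ∷ v , (begin
  string m (c ∷ cs)                        ≡⟨ eq ⟩
  (𝟐^ m ++ c) ++ 𝟐^ (suc m) ++ v           ≡⟨ cong (λ e → (𝟐^ m ++ c) ++ e ++ v) (𝟐^-∷ʳ m) ⟨
  (𝟐^ m ++ c) ++ (𝟐^ m ++ [ 𝟐 ]) ++ v      ≡⟨ cong ((𝟐^ m ++ c) ++_) (++-assoc (𝟐^ m) [ 𝟐 ] v) ⟩
  (𝟐^ m ++ c) ++ 𝟐^ m ++ 𝟐 ∷ v             ≡⟨ ++-assoc (𝟐^ m ++ c) (𝟐^ m) (𝟐 ∷ v) ⟨
  ((𝟐^ m ++ c) ++ 𝟐^ m) ++ 𝟐 ∷ v           ≡⟨ cong (_++ 𝟐 ∷ v) (++-assoc (𝟐^ m) c (𝟐^ m)) ⟩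
  block m c ++ 𝟐 ∷ v                       ∎)
  where open ≡-Reasoning
block-Occurs-string m (d ∷ cs) (there c∈) =
  Occurs-++ˡ (𝟐^ m) (Occurs-++ˡ d (Occurs-++ˡ [ 𝟐 ] (block-Occurs-string m cs c∈)))

module _ (m n : ℕ) (cs : List Word)
         (free : ∀ {c} → c ∈ cs → ¬ Occurs (𝟐^ (suc m)) (block m c))
         (len : ∀ {c} → c ∈ cs → length (block m c) ≡ n) where

  private
    ¬Factor : ∀ {z} → ¬ Occurs (𝟐^ (suc m)) z → ¬ Factor (𝟐^ (suc m)) z
    ¬Factor h o = h (Factor⇒Occurs _ _ o)

    ¬Occurs : ∀ {z} → ¬ Factor (𝟐^ (suc m)) z → ¬ Occurs (𝟐^ (suc m)) z
    ¬Occurs h o = h (Occurs⇒Factor _ _ o)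

    in-block : ∀ {c₀ z} → c₀ ∈ cs → ¬ Factor (𝟐^ (suc m)) z → Factor z (string m cs) →
               ∃[ c ] c ∈ cs × Occurs z (block m c)
    in-block {c₀} {z} c₀∈ z-free o
      with Occurs-string m cs (¬Occurs z-free) (Factor⇒Occurs z _ o)
    -- The final 2ᵐ also opens every block, so any member `c₀` of the list will do.
    ... | inj₁ o′ = c₀ , c₀∈ , Occurs-++ʳ (c₀ ++ 𝟐^ m) o′
    ... | inj₂ r  = r

  Maximal⇒block : ∀ {c₀} → c₀ ∈ cs → ∀ z → Maximal (string m cs) (𝟐^ (suc m)) z →
                  ∃[ c ] c ∈ cs × z ≡ block m c
  Maximal⇒block c₀∈ z (o , z-free , max) with in-block c₀∈ z-free o
  ... | c , c∈ , o′ =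
    c , c∈ , sym (max (block m c) (Occurs⇒Factor z _ o′)
                      (Occurs⇒Factor _ _ (block-Occurs-string m cs c∈)) (¬Factor (free c∈)))

  -- A free factor around a block lies in some block itself, and as all blocks have the same length
  -- it cannot be longer than the one it contains.
  block⇒Maximal : ∀ {c} → c ∈ cs → Maximal (string m cs) (𝟐^ (suc m)) (block m c)
  block⇒Maximal {c} c∈ =
    Occurs⇒Factor _ _ (block-Occurs-string m cs c∈) , ¬Factor (free c∈) , max
    where
    max : ∀ z → Factor (block m c) z → Factor z (string m cs) → ¬ Factor (𝟐^ (suc m)) z →
          z ≡ block m c
    max z o o′ z-free with in-block c∈ z-free o′
    ... | d , d∈ , o″ =
      sym (Occurs-length-≡ (Factor⇒Occurs (block m c) z o)
             (subst (length z ≤_) (trans (len d∈) (sym (len c∈))) (Occurs-length o″)))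

-- Longest common prefixes

Lcp-++ : ∀ x {a b u v} → a ≢ b → Lcp x (x ++ a ∷ u) (x ++ b ∷ v)
Lcp-++ x a≢b = ⊑-++ _ , ⊑-++ _ , common x a≢b
  where
  common : ∀ x {a b u v} → a ≢ b → ∀ w → w ⊑ x ++ a ∷ u → w ⊑ x ++ b ∷ v → w ⊑ x
  common x       a≢b []      _ _ = x , refl
  common []      a≢b (_ ∷ w) p q = ⊥-elim (a≢b (trans (sym (proj₁ (⊑-∷⁻ p))) (proj₁ (⊑-∷⁻ q))))
  common (c ∷ x) a≢b (_ ∷ w) p q with ⊑-∷⁻ p | ⊑-∷⁻ q
  ... | refl , p′ | _ , q′ = ⊑-∷ c (common x a≢b w p′ q′)

Lcp-unique : ∀ {x y z k} → Lcp x z k → Lcp y z k → x ≡ y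
Lcp-unique (xz , xk , xmax) (yz , yk , ymax) = ⊑-antisym (ymax _ xz xk) (xmax _ yz yk)

Lcp-resp : ∀ {x z z′ k k′} → z ≡ z′ → k ≡ k′ → Lcp x z′ k′ → Lcp x z k
Lcp-resp refl refl l = l

-- Completeness

splits : Word → List (Word × Word)
splits []      = [ [] , [] ]
splits (a ∷ t) = ([] , a ∷ t) ∷ map (λ (p , q) → a ∷ p , q) (splits t)

∈-splits⁺ : ∀ p q → (p , q) ∈ splits (p ++ q)
∈-splits⁺ []      []      = here refl
∈-splits⁺ []      (_ ∷ _) = here refl
∈-splits⁺ (a ∷ p) q       = there (∈-map⁺ _ (∈-splits⁺ p q))

∈-splits⁻ : ∀ t {p q} → (p , q) ∈ splits t → p ++ q ≡ t
∈-splits⁻ []      (here refl) = refl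
∈-splits⁻ (a ∷ t) (here refl) = refl
∈-splits⁻ (a ∷ t) (there i) with ∈-map⁻ _ i
... | _ , j , refl = cong (a ∷_) (∈-splits⁻ t j)

flip : Letter → Letter
flip 𝟏 = 𝟐
flip 𝟐 = 𝟏

flip-≢ : ∀ a → flip a ≢ a
flip-≢ 𝟏 ()
flip-≢ 𝟐 ()

-- The default `𝟏` matters: `first q` is to be the first letter of q1, with which `K` continues
-- after `left p`. Likewise `first (reverse p)` is the last letter of 1p.
first : Word → Letter
first []      = 𝟏
first (a ∷ _) = a

first-++ : ∀ q e → ∃[ q′ ] q ++ 𝟏 ∷ e ≡ first q ∷ q′
first-++ []      e = e , refl
first-++ (a ∷ q) e = q ++ 𝟏 ∷ e , refl

length-insert₂ : ∀ x {a b : Letter} y → length (x ++ a ∷ b ∷ y) ≡ 2 + length (x ++ y)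
length-insert₂ []      y = refl
length-insert₂ (_ ∷ x) y = cong suc (length-insert₂ x y)

module Witness (t : Word) where

  m : ℕ
  -- This is the length of the stretch p ā b̄ q between the outer 1s of a core, which is thus too
  -- short to contain `G`.
  m = 2 + length t

  left right : Word → Word
  left  p = 𝟐^ m ++ 𝟏 ∷ p
  right q = q ++ 𝟏 ∷ 𝟐^ m

  core : Word × Word → Word
  core (p , q) = 𝟏 ∷ p ++ flip (first q) ∷ flip (first (reverse p)) ∷ q ++ [ 𝟏 ]

  cores : List Word
  cores = map core (splits t)

  W G K : Word
  W = string m cores
  G = 𝟐^ (suc m)
  K = 𝟐^ m ++ 𝟏 ∷ t ++ 𝟏 ∷ 𝟐^ m

  left-right : ∀ p q → left p ++ right q ≡ 𝟐^ m ++ 𝟏 ∷ (p ++ q) ++ 𝟏 ∷ 𝟐^ m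
  left-right p q =
    trans (++-assoc (𝟐^ m) (𝟏 ∷ p) (right q)) (cong (λ e → 𝟐^ m ++ 𝟏 ∷ e) (sym (++-assoc p q _)))

  block-core : ∀ p q → block m (core (p , q)) ≡
               left p ++ flip (first q) ∷ flip (first (reverse p)) ∷ right q
  block-core p q = begin
    𝟐^ m ++ 𝟏 ∷ (p ++ a ∷ b ∷ q ++ [ 𝟏 ]) ++ 𝟐^ m
      ≡⟨ cong (λ e → 𝟐^ m ++ 𝟏 ∷ e) (++-assoc p (a ∷ b ∷ q ++ [ 𝟏 ]) (𝟐^ m)) ⟩
    𝟐^ m ++ 𝟏 ∷ p ++ a ∷ b ∷ (q ++ [ 𝟏 ]) ++ 𝟐^ m
      ≡⟨ cong (λ e → 𝟐^ m ++ 𝟏 ∷ p ++ a ∷ b ∷ e) (++-assoc q [ 𝟏 ] (𝟐^ m)) ⟩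
    𝟐^ m ++ 𝟏 ∷ p ++ a ∷ b ∷ right q
      ≡⟨ ++-assoc (𝟐^ m) (𝟏 ∷ p) _ ⟨
    left p ++ a ∷ b ∷ right q ∎
    where
    open ≡-Reasoning
    a = flip (first q)
    b = flip (first (reverse p))

  ∈-cores⁺ : ∀ p q → p ++ q ≡ t → core (p , q) ∈ cores
  ∈-cores⁺ p q eq = ∈-map⁺ core (subst (λ u → (p , q) ∈ splits u) eq (∈-splits⁺ p q))

  ∈-cores⁻ : ∀ {c} → c ∈ cores → ∃[ p ] ∃[ q ] p ++ q ≡ t × c ≡ core (p , q)
  ∈-cores⁻ c∈ with ∈-map⁻ core c∈
  ... | (p , q) , i , eq = p , q , ∈-splits⁻ t i , eq

  -- Every block is `K` with two letters inserted where `t` is split, so all splits give the same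
  -- length.
  block-length : ∀ {c} → c ∈ cores → length (block m c) ≡ 2 + length K
  block-length c∈ with ∈-cores⁻ c∈
  ... | p , q , refl , refl =
    trans (cong length (block-core p q))
      (trans (length-insert₂ (left p) (right q)) (cong (λ e → 2 + length e) (left-right p q)))

  -- The 1s around p ā b̄ q cut a block into three pieces of m letters each, and a run of m + 1
  -- letters 2 would have to fit into one of them.
  block-free : ∀ {c} → c ∈ cores → ¬ Occurs G (block m c)
  block-free c∈ o with ∈-cores⁻ c∈
  ... | p , q , eq , refl =
    case 𝟐^-around-𝟏 (suc m) (𝟐^ m) (subst (Occurs G) regroup o) of λ
      { (inj₁ o′) → 𝟐^-long (≤-reflexive (length-𝟐^ m)) o′
      ; (inj₂ o′) → case 𝟐^-around-𝟏 (suc m) (p ++ _ ∷ _ ∷ q) o′ of λ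
          { (inj₁ o″) → 𝟐^-long (≤-reflexive (trans (length-insert₂ p q) (cong (λ e → 2 + length e) eq))) o″
          ; (inj₂ o″) → 𝟐^-long (≤-reflexive (length-𝟐^ m)) o″ } }
    where
    a = flip (first q)
    b = flip (first (reverse p))

    regroup : block m (core (p , q)) ≡ 𝟐^ m ++ 𝟏 ∷ (p ++ a ∷ b ∷ q) ++ 𝟏 ∷ 𝟐^ m
    regroup = trans (block-core p q)
      (trans (++-assoc (𝟐^ m) (𝟏 ∷ p) _) (cong (λ e → 𝟐^ m ++ 𝟏 ∷ e) (sym (++-assoc p (a ∷ b ∷ q) _))))

  -- After `left p`, `K` goes on with the first letter of q1 and the block with the other letter.
  left-Lcp : ∀ p q → p ++ q ≡ t → Lcp (left p) (block m (core (p , q))) K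
  left-Lcp p q refl =
    Lcp-resp (block-core p q)
      (trans (sym (left-right p q)) (cong (left p ++_) (proj₂ (first-++ q (𝟐^ m)))))
      (Lcp-++ (left p) (flip-≢ (first q)))

  -- The mirror image: read from the right, `right q` is followed by the last letter of 1p in `K`
  -- and by the other letter in the block.
  right-Lcp : ∀ p q → p ++ q ≡ t →
              Lcp (reverse (right q)) (reverse (block m (core (p , q)))) (reverse K)
  right-Lcp p q refl =
    Lcp-resp (trans (cong reverse (block-core p q)) reverse-block)
      (trans (cong reverse (sym (left-right p q))) reverse-K)
      (Lcp-++ (reverse (right q)) (flip-≢ (first (reverse p))))
    where
    open ≡-Reasoning
    a = flip (first q)
    b = flip (first (reverse p))

    reverse-block : reverse (left p ++ a ∷ b ∷ right q) ≡ reverse (right q) ++ b ∷ a ∷ reverse (left p)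
    reverse-block = begin
      reverse (left p ++ a ∷ b ∷ right q)
        ≡⟨ reverse-++-∷ (left p) a (b ∷ right q) ⟩
      reverse (b ∷ right q) ++ a ∷ reverse (left p)
        ≡⟨ cong (_++ a ∷ reverse (left p)) (unfold-reverse b (right q)) ⟩
      (reverse (right q) ++ [ b ]) ++ a ∷ reverse (left p)
        ≡⟨ ++-assoc (reverse (right q)) [ b ] _ ⟩
      reverse (right q) ++ b ∷ a ∷ reverse (left p) ∎

    reverse-K : reverse (left p ++ right q) ≡
                reverse (right q) ++ first (reverse p) ∷ proj₁ (first-++ (reverse p) (𝟐^ m))
    reverse-K = trans (reverse-++ (left p) (right q))
      (cong (reverse (right q) ++_) (trans (reverse-padded p m) (proj₂ (first-++ (reverse p) (𝟐^ m)))))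

  Coded⇒split : ∀ x y → Coded W G K x y → ∃[ p ] ∃[ q ] p ++ q ≡ t × x ≡ left p × y ≡ right q
  Coded⇒split x y (z , max , lx , ly)
    -- The split `([] , t)` provides the required member of `cores`.
    with Maximal⇒block m _ cores block-free block-length (∈-cores⁺ [] t refl) z max
  ... | c , c∈ , refl with ∈-cores⁻ c∈
  ... | p , q , eq , refl =
    p , q , eq , Lcp-unique lx (left-Lcp p q eq) ,
    reverse-injective (Lcp-unique ly (right-Lcp p q eq))

  split⇒Coded : ∀ p q → p ++ q ≡ t → Coded W G K (left p) (right q)
  split⇒Coded p q eq =
    block m (core (p , q)) , block⇒Maximal m _ cores block-free block-length (∈-cores⁺ p q eq) ,
    left-Lcp p q eq , right-Lcp p q eq

  left-Snoc : ∀ a p → Snoc a (left p) (left (p ++ [ a ]))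
  left-Snoc a p = subst (Snoc a (left p)) (++-assoc (𝟐^ m) (𝟏 ∷ p) [ a ]) (Snoc-++ a (left p))

  right-Snoc : ∀ a q → Snoc a (reverse (right q)) (reverse (right (a ∷ q)))
  right-Snoc a q =
    subst (Snoc a (reverse (right q))) (sym (unfold-reverse a (right q))) (Snoc-++ a (reverse (right q)))

  -- An empty first part gives the base pair. Otherwise its last letter `a` goes back to the front
  -- of `q`; the result is again a split of `t`, hence coded.
  closed : Closed W G K (left []) (right t)
  closed x y c with Coded⇒split x y c
  ... | p , q , eq , refl , refl with initLast p
  ... | [] = inj₁ (refl , cong right eq)
  ... | p′ ∷ʳ′ a =
    inj₂ (left p′ , right (a ∷ q) , split⇒Coded p′ (a ∷ q) (trans (sym (++-assoc p′ [ a ] q)) eq) ,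
          by-letter a (left-Snoc a p′ , right-Snoc a q))
    where
    Moves : Letter → Set
    Moves b = Snoc b (left p′) (left (p′ ++ [ a ])) × Snoc b (reverse (right q)) (reverse (right (a ∷ q)))

    by-letter : ∀ b → Moves b → Moves 𝟏 ⊎ Moves 𝟐
    by-letter 𝟏 = inj₁
    by-letter 𝟐 = inj₂


  concat′-complete : ∀ r s → r ++ s ≡ t → 𝔖⊨ concat′ [ r ∷ s ∷ t ∷ [] ]
  concat′-complete r s eq =
    W , G , K , left [] , right t , left r , right s ,
    Pad-reverse-++ [] m , Pad-++ t m , Pad-reverse-++ r m , Pad-++ s m ,
    split⇒Coded r s eq , closed

mainTheorem3 : Σ[ φ ∈ Formula 3 ] (∀ (r s t : Word) → (𝔖⊨ φ [ r ∷ s ∷ t ∷ [] ]) ⇔ (r ++ s ≡ t))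
mainTheorem3 = concat′ , λ r s t → mk⇔ (concat′-sound r s t) (Witness.concat′-complete t r s)
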